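{- For every integer $n\geqslant 3$, the orbit number of the $n$-dimensional crossed cube satisfies $\text{Orb}(\text{CQ}_n)=2^{\lceil n/2\rceil-2}$.
   Context: Two 2-bit strings $x_2x_1$ and $y_2y_1$ are pair related, written $x_2x_1\sim y_2y_1$, iff $(x_2x_1,y_2y_1)\in\{(00,00),(10,10),(01,11),(11,01)\}$. The $n$-dimensional crossed cube $\text{CQ}_n$ has as vertices all binary strings $u=u_{n-1}\ldots u_0$ of length $n$. Two vertices $u,v$ are adjacent iff there is an index $x$ with $0\leqslant x\leqslant n-1$ such that: (1) $v_x\neq u_x$; (2) if $x$ is odd, $v_{x-1}=u_{x-1}$; (3) $v_i=u_i$ for all $i>x$; (4) $u_{2i+1}u_{2i}\sim v_{2i+1}v_{2i}$ for all $0\leqslant i\leqslant\lfloor x/2\rfloor-1$. An orbit of a graph $G$ is an orbit of the action of its automorphism group on $V(G)$ (a maximal set of vertices any two of which are mapped to each other by some automorphism), and $\text{Orb}(G)$ is the number of such orbits. -}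

module Defs where

open import Data.Nat using (ℕ; zero; suc; _+_; _*_; _∸_; _<_; _%_; _/_)
open import Data.Bool using (Bool; true; false)
open import Data.Vec using (Vec; []; _∷_)
open import Data.Fin using (Fin)
open import Data.Product using (Σ; _×_; ∃-syntax; Σ-syntax)
open import Relation.Binary.PropositionalEquality using (_≡_; _≢_)
open import Function using (Surjective)
open import Function.Bundles using (_⇔_)

-- Bit u_k of a vertex u = u_{n-1} ... u_0, stored as a vector whose
-- k-th entry (from the front) is u_k.  Out-of-range indices give false
-- (never used in the adjacency definition below, which only queries k < n).
bit : ∀ {n} → Vec Bool n → ℕ → Bool
bit []       _       = false
bit (b ∷ _)  zero    = b
bit (_ ∷ bs) (suc k) = bit bs k

data PairRel : Bool → Bool → Bool → Bool → Set where
  p00-00 : PairRel false false false false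
  p10-10 : PairRel true  false true  false
  p01-11 : PairRel false true  true  true
  p11-01 : PairRel true  true  false true

CQAdj : (n : ℕ) → Vec Bool n → Vec Bool n → Set
CQAdj n u v = Σ[ x ∈ ℕ ]
    ( x < n
    × bit v x ≢ bit u x
    × (x % 2 ≡ 1 → bit v (x ∸ 1) ≡ bit u (x ∸ 1))
    × (∀ i → x < i → i < n → bit v i ≡ bit u i)
    × (∀ i → i < x / 2 →
         PairRel (bit u (2 * i + 1)) (bit u (2 * i)) (bit v (2 * i + 1)) (bit v (2 * i))))

record Automorphism {V : Set} (Adj : V → V → Set) : Set where
  field
    to       : V → V
    from     : V → V
    to-from  : ∀ v → to (from v) ≡ v
    from-to  : ∀ v → from (to v) ≡ v
    preserves : ∀ u v → Adj u v ⇔ Adj (to u) (to v)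

SameOrbit : {V : Set} (Adj : V → V → Set) → V → V → Set
SameOrbit Adj u v = Σ[ f ∈ Automorphism Adj ] Automorphism.to f u ≡ v

-- Orb(G) = k : there is a surjection V → Fin k whose fibres are exactly the
-- orbits, i.e. a bijection between the set of orbits and Fin k.
OrbitCount : {V : Set} (Adj : V → V → Set) → ℕ → Set
OrbitCount {V} Adj k = Σ[ c ∈ (V → Fin k) ]
    ( Surjective _≡_ _≡_ c
    × (∀ u v → (c u ≡ c v) ⇔ SameOrbit Adj u v))

{-# OPTIONS --safe #-}
module Submission where

-- Adding a new lowest pair turns CQₙ into CQₙ₊₂: the new edges flip the even bit a or the odd bit c
-- of that pair, and an old edge now also adds a to c.  For n ≥ 3, the flips of a are the only edges
-- lying in fewer than two squares, and the flip of c spans the only square over the flip of a.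
-- So an automorphism of CQₙ₊₂ preserves the new and the old edges and induces one of CQₙ.  As CQₙ
-- has a closed walk of length 5 at every vertex, while a walk of length 5 along old edges adds
-- 5a = a to c, the bit a is invariant.  Conversely every automorphism of CQₙ lifts, and c can be
-- changed freely, so the number of orbits doubles.  For n < 3, CQₙ is bipartite with
-- 2-colouring h, and (a , c , t) ↦ (¬ a , h t xor c , t) makes CQ₃ and CQ₄ vertex-transitive.

open import Defs
open import Data.Nat using (ℕ; _≤_; _^_; _∸_; ⌈_/2⌉)
open import Data.Nat
  using (zero; suc; _+_; _*_; _<_; _/_; _%_; z≤n; s≤s; z<s; s<s; ⌊_/2⌋)
open import Data.Nat.Properties using (*-suc)
open import Data.Nat.DivMod using (+-distrib-/-∣ˡ)
open import Data.Nat.Divisibility using (∣-refl)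
open import Data.Bool using (Bool; true; false; not; _xor_)
open import Data.Bool.Properties using (not-¬; ¬-not; not-involutive)
open import Data.Empty using (⊥; ⊥-elim)
open import Data.Fin using (Fin; zero; combine)
open import Data.Fin.Properties using (combine-injective; combine-surjective; 2↔Bool)
open import Data.Product using (∃; ∃-syntax; Σ-syntax; _×_; _,_; proj₁; proj₂)
open import Data.Sum using (_⊎_; inj₁; inj₂)
open import Data.Unit using (⊤; tt)
open import Data.Vec using (Vec; []; _∷_)
open import Function using (_∘_)
open import Function.Bundles using (mk⇔; Equivalence; Inverse)
open import Function.Consequences.Propositional using (strictlySurjective⇒surjective)
open import Relation.Binary.PropositionalEquality
  using (_≡_; _≢_; refl; sym; trans; cong; cong₂; subst; subst₂)
open import Relation.Nullary using (¬_)

open Equivalence using () renaming (to to _⟶; from to _⟵)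

-- Automorphisms, squares and pentagons.

module _ {V : Set} {Adj : V → V → Set} where

  automorphism : (f g : V → V) → (∀ v → f (g v) ≡ v) → (∀ v → g (f v) ≡ v) →
                 (∀ {u v} → Adj u v → Adj (f u) (f v)) →
                 (∀ {u v} → Adj u v → Adj (g u) (g v)) → Automorphism Adj
  automorphism f g fg gf f-mono g-mono = record
    { to = f ; from = g ; to-from = fg ; from-to = gf
    ; preserves = λ u v → mk⇔ f-mono λ e → subst₂ Adj (gf u) (gf v) (g-mono e) }

  identity : Automorphism Adj
  identity = automorphism (λ v → v) (λ v → v) (λ _ → refl) (λ _ → refl) (λ e → e) (λ e → e)

  module _ (f : Automorphism Adj) where
    open Automorphism f

    to-mono : ∀ {u v} → Adj u v → Adj (to u) (to v)
    to-mono {u} {v} = preserves u v ⟶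

    to-injective : ∀ {u v} → to u ≡ to v → u ≡ v
    to-injective {u} {v} e = trans (sym (from-to u)) (trans (cong from e) (from-to v))

    from-mono : ∀ {u v} → Adj u v → Adj (from u) (from v)
    from-mono {u} {v} e =
      (preserves (from u) (from v) ⟵) (subst₂ Adj (sym (to-from u)) (sym (to-from v)) e)

    inverse : Automorphism Adj
    inverse = automorphism from to from-to to-from from-mono to-mono

module _ {V : Set} (Adj : V → V → Set) where

  -- The 4-cycle `u`, `v`, `s`, `w` through the edge `u v`, indexed by the neighbour `w` of `u`;
  -- `InTwoSquares` thus counts values of `w`, not of `s`.
  Square : V → V → V → Set
  Square u v w = Adj u w × w ≢ v × Σ[ s ∈ V ] (Adj v s × Adj w s × s ≢ u)

  InTwoSquares : V → V → Set
  InTwoSquares u v = Σ[ w ∈ V ] Σ[ w′ ∈ V ] (w ≢ w′ × Square u v w × Square u v w′)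

  -- The vertices may repeat: only the odd length of the closed walk matters.
  Pentagon : V → Set
  Pentagon u = Σ[ p ∈ V ] Σ[ q ∈ V ] Σ[ r ∈ V ] Σ[ s ∈ V ]
    (Adj u p × Adj p q × Adj q r × Adj r s × Adj s u)

module _ {V : Set} {Adj : V → V → Set} (f : Automorphism Adj) where
  open Automorphism f

  square-to : ∀ {u v w} → Square Adj u v w → Square Adj (to u) (to v) (to w)
  square-to (e , w≢v , s , e₁ , e₂ , s≢u) =
    to-mono f e , w≢v ∘ to-injective f , to s , to-mono f e₁ , to-mono f e₂ , s≢u ∘ to-injective f

  inTwoSquares-to : ∀ {u v} → InTwoSquares Adj u v → InTwoSquares Adj (to u) (to v)
  inTwoSquares-to (w , w′ , w≢w′ , S , S′) =
    to w , to w′ , w≢w′ ∘ to-injective f , square-to S , square-to S′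

module _ {V : Set} {Adj : V → V → Set} (f : Automorphism Adj) where
  open Automorphism f

  inTwoSquares-from : ∀ {u v} → InTwoSquares Adj (to u) (to v) → InTwoSquares Adj u v
  inTwoSquares-from {u} {v} S =
    subst₂ (InTwoSquares Adj) (from-to u) (from-to v) (inTwoSquares-to (inverse f) S)

record Simple {V : Set} (Adj : V → V → Set) : Set where
  field
    irreflexive : ∀ {u v} → Adj u v → u ≢ v
    symmetric   : ∀ {u v} → Adj u v → Adj v u

-- What the lower graph must supply: `square` gives high edges of the extension a second square, and
-- `pentagon` makes the even bit invariant.
record Rich {V : Set} (Adj : V → V → Set) : Set where
  field
    simple   : Simple Adj
    square   : ∀ {u v} → Adj u v → ∃ (Square Adj u v)
    pentagon : ∀ u → Pentagon Adj u

xor-cancel : ∀ x y → x xor (x xor y) ≡ y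
xor-cancel false _ = refl
xor-cancel true  y = not-involutive y

xor-not : ∀ x y → x xor not y ≡ not (x xor y)
xor-not false _ = refl
xor-not true  _ = refl

not-xor : ∀ x y → not x xor y ≡ not (x xor y)
not-xor false _ = refl
not-xor true  y = sym (not-involutive y)

xor-swap : ∀ x y → (x xor y) xor x ≡ y
xor-swap false false = refl
xor-swap false true  = refl
xor-swap true  false = refl
xor-swap true  true  = refl

-- Extending a graph by a lowest pair.

Pairs : Set → Set
Pairs V = Bool × Bool × V

flipEven flipOdd : ∀ {V} → Pairs V → Pairs V
flipEven (a , c , t) = not a , c , t
flipOdd  (a , c , t) = a , not c , t

lift : ∀ {V} → Pairs V → V → Pairs V
lift (a , c , _) t = a , a xor c , t

evenBit oddBit : ∀ {V} → Pairs V → Bool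
evenBit = proj₁
oddBit  = proj₁ ∘ proj₂

rest : ∀ {V} → Pairs V → V
rest = proj₂ ∘ proj₂

-- If Adj is CQₙ, this is CQₙ₊₂: (a , c , t) stands for the vertex t c a, with lowest pair c a,
-- and c a ∼ c′ a′ means that a′ = a and c′ = a xor c.
data Extend {V : Set} (Adj : V → V → Set) (u v : Pairs V) : Set where
  even : v ≡ flipEven u → Extend Adj u v
  odd  : v ≡ flipOdd u → Extend Adj u v
  high : ∀ {t} → Adj (rest u) t → v ≡ lift u t → Extend Adj u v

module _ {V : Set} {Adj : V → V → Set} where

  flipEven-≢ : (u : Pairs V) → flipEven u ≢ u
  flipEven-≢ _ e = not-¬ refl (sym (cong evenBit e))

  flipOdd-≢ : (u : Pairs V) → flipOdd u ≢ u
  flipOdd-≢ _ e = not-¬ refl (sym (cong oddBit e))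

  extend-simple : Simple Adj → Simple (Extend Adj)
  extend-simple simple = record { irreflexive = irr ; symmetric = symm }
    where
    open Simple simple
    irr : ∀ {u v} → Extend Adj u v → u ≢ v
    irr {u} (even e) refl = flipEven-≢ u (sym e)
    irr {u} (odd e)  refl = flipOdd-≢ u (sym e)
    irr (high e e′)  refl = irreflexive e (cong rest e′)
    symm : ∀ {u v} → Extend Adj u v → Extend Adj v u
    symm {a , c , t} (even refl)   = even (cong (_, c , t) (sym (not-involutive a)))
    symm {a , c , t} (odd refl)    = odd (cong (λ z → a , z , t) (sym (not-involutive c)))
    symm {a , c , t} (high e refl) = high (symmetric e) (cong (λ z → a , z , t) (sym (xor-cancel a c)))

  module _ (simple : Simple Adj) where
    open Simple simple

    -- `flipOdd` commutes with `lift`, since `a xor not c` is `not (a xor c)`. `flipEven` does not: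
    -- it changes what `lift` adds to the odd bit.
    oddHighSquare : ∀ u {t} → Adj (rest u) t → Square (Extend Adj) u (flipOdd u) (lift u t)
    oddHighSquare u@(a , c , _) {t} e =
      high e refl ,
      (λ eq → irreflexive e (sym (cong rest eq))) ,
      flipOdd (lift u t) ,
      high e (cong (λ z → a , z , t) (sym (xor-not a c))) , odd refl ,
      λ eq → irreflexive e (sym (cong rest eq))

    highOddSquare : ∀ u {t} → Adj (rest u) t → Square (Extend Adj) u (lift u t) (flipOdd u)
    highOddSquare u e =
      let (_ , w≢v , s , e₁ , e₂ , s≢u) = oddHighSquare u e
      in odd refl , w≢v ∘ sym , s , e₂ , e₁ , s≢u

    evenOddSquare : ∀ u → Square (Extend Adj) u (flipEven u) (flipOdd u)
    evenOddSquare u =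
      odd refl , (λ eq → not-¬ refl (cong evenBit eq)) , flipEven (flipOdd u) ,
      odd refl , even refl , λ eq → not-¬ refl (sym (cong evenBit eq))

    oddEvenSquare : ∀ u → Square (Extend Adj) u (flipOdd u) (flipEven u)
    oddEvenSquare u =
      let (_ , w≢v , s , e₁ , e₂ , s≢u) = evenOddSquare u
      in even refl , w≢v ∘ sym , s , e₂ , e₁ , s≢u

    extend-rich : (∀ u → ∃ (Adj u)) → Rich (Extend Adj)
    extend-rich neighbour = record
      { simple = extend-simple simple ; square = sq ; pentagon = pent }
      where
      sq : ∀ {u v} → Extend Adj u v → ∃ (Square (Extend Adj) u v)
      sq {u} (even refl)   = flipOdd u , evenOddSquare u
      sq {u} (odd refl)    = flipEven u , oddEvenSquare u
      sq {u} (high e refl) = flipOdd u , highOddSquare u e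
      -- Conjugating a high edge by a flip of the even bit changes the odd bit.
      pent : ∀ u → Pentagon (Extend Adj) u
      pent u@(a , c , t) =
        let (t′ , e) = neighbour t in
        flipEven u , lift (flipEven u) t′ , (a , not a xor c , t′) , flipOdd u ,
        even refl , high e refl ,
        even (cong (_, not a xor c , t′) (sym (not-involutive a))) ,
        high (symmetric e) (cong (λ z → a , z , t)
          (sym (trans (cong (a xor_) (not-xor a c)) (trans (xor-not a (a xor c)) (cong not (xor-cancel a c)))))) ,
        odd (cong (λ z → a , z , t) (sym (not-involutive c)))

    -- Only even edges change the even bit, so the edge opposite the given one is even too, and the
    -- two sides are odd or high. One odd and one high side would end over different vertices of the
    -- lower graph; two high sides would add `a` and `not a` to the same odd bit. Both sides are
    -- therefore odd.
    evenSquare-unique : ∀ {u w} → Square (Extend Adj) u (flipEven u) w → w ≡ flipOdd u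
    evenSquare-unique (even e , w≢v , _) = ⊥-elim (w≢v e)
    evenSquare-unique (odd e , _) = e
    evenSquare-unique {a , c , t} (high _ _ , _ , _ , even e , _ , s≢u) =
      ⊥-elim (s≢u (trans e (cong (_, c , t) (not-involutive a))))
    evenSquare-unique (high e refl , _ , _ , odd refl , even e′ , _) =
      ⊥-elim (irreflexive e (cong rest e′))
    evenSquare-unique (high e refl , _ , _ , odd refl , odd e′ , _) =
      ⊥-elim (irreflexive e (cong rest e′))
    evenSquare-unique (high e refl , _ , _ , odd refl , high _ e′ , _) =
      ⊥-elim (not-¬ refl (sym (cong evenBit e′)))
    evenSquare-unique {a , c , _} (high _ refl , _ , _ , high _ refl , even e′ , _) =
      ⊥-elim (not-¬ refl (trans (sym (cong oddBit e′)) (not-xor a c)))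
    evenSquare-unique (high _ refl , _ , _ , high _ refl , odd e′ , _) =
      ⊥-elim (not-¬ refl (sym (cong evenBit e′)))
    evenSquare-unique (high _ refl , _ , _ , high _ refl , high _ e′ , _) =
      ⊥-elim (not-¬ refl (sym (cong evenBit e′)))

    even-¬inTwoSquares : ∀ u → ¬ InTwoSquares (Extend Adj) u (flipEven u)
    even-¬inTwoSquares u (_ , _ , w≢w′ , S , S′) =
      w≢w′ (trans (evenSquare-unique S) (sym (evenSquare-unique S′)))

  -- From automorphisms of the extension to automorphisms below.

  module _ (rich : Rich Adj) where
    open Rich rich
    open Simple simple

    -- An odd edge spans one square with the even flip and one with a high edge. A high edge spans
    -- one with the odd flip and one lifted from a square of `Adj`.
    even⊎inTwoSquares : ∀ {u v} → Extend Adj u v → v ≡ flipEven u ⊎ InTwoSquares (Extend Adj) u v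
    even⊎inTwoSquares (even e) = inj₁ e
    even⊎inTwoSquares {u} (odd refl) =
      -- The pentagon is used here just as a source of a neighbour of `rest u`.
      let (t , _ , _ , _ , e , _) = pentagon (rest u) in
      inj₂ (flipEven u , lift u t , (λ eq → not-¬ refl (sym (cong evenBit eq))) ,
            oddEvenSquare simple u , oddHighSquare simple u e)
    even⊎inTwoSquares {u@(a , c , _)} (high {t} e refl) =
      let (w , e₁ , w≢t , s , e₂ , e₃ , s≢) = square e in
      inj₂ (flipOdd u , lift u w , (λ eq → irreflexive e₁ (cong rest eq)) ,
            highOddSquare simple u e ,
            -- Both sides of the lifted square add the same even bit twice, so they meet in one
            -- vertex.
            high e₁ refl , (λ eq → w≢t (cong rest eq)) , lift (lift u t) s ,
            high e₂ refl , high e₃ refl , λ eq → s≢ (cong rest eq))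

    High : Pairs V → Pairs V → Set
    High u v = Adj (rest u) (rest v) × v ≡ lift u (rest v)

    -- Along a high edge the odd bit changes by the even bit, and 5 is odd.
    highPentagon : ∀ {u p q r s} → High u p → High p q → High q r → High r s → High s u →
                   evenBit u ≡ false
    highPentagon {false , _} _ _ _ _ _ = refl
    highPentagon {true , false , _} (_ , refl) (_ , refl) (_ , refl) (_ , refl) (_ , ())
    highPentagon {true , true , _}  (_ , refl) (_ , refl) (_ , refl) (_ , refl) (_ , ())

    module _ (f : Automorphism (Extend Adj)) where
      open Automorphism f

      -- If the image edge lay in two squares, the inverse would carry them back to the even edge.
      to-flipEven : ∀ u → to (flipEven u) ≡ flipEven (to u)
      to-flipEven u with even⊎inTwoSquares (to-mono f (even {u = u} refl))
      ... | inj₁ e = e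
      ... | inj₂ S = ⊥-elim (even-¬inTwoSquares simple u (inTwoSquares-from f S))

      to-flipOdd : ∀ u → to (flipOdd u) ≡ flipOdd (to u)
      to-flipOdd u = evenSquare-unique simple
        (subst (λ v → Square (Extend Adj) (to u) v (to (flipOdd u))) (to-flipEven u)
          (square-to f (evenOddSquare simple u)))

      -- Both flips of `to u` are already images of flips of `u`, so by injectivity a high edge is
      -- all that remains.
      to-high : ∀ u {t} → Adj (rest u) t → High (to u) (to (lift u t))
      to-high u e with to-mono f (high {u = u} e refl)
      ... | even e′ = ⊥-elim (irreflexive e (sym (cong rest
                        (to-injective f (trans e′ (sym (to-flipEven u)))))))
      ... | odd e′  = ⊥-elim (irreflexive e (sym (cong rest
                        (to-injective f (trans e′ (sym (to-flipOdd u)))))))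
      ... | high e₁ e′ =
        let e″ = sym (cong rest e′)
        in subst (Adj _) e″ e₁ , trans e′ (cong (lift (to u)) e″)

      restMap : V → V
      restMap t = rest (to (false , false , t))

      -- Commuting with both flips makes the choice of the representative `(false , false , t)` in
      -- `restMap` immaterial.
      rest-to : ∀ u → rest (to u) ≡ restMap (rest u)
      rest-to (false , false , t) = refl
      rest-to (true  , false , t) = cong rest (to-flipEven (false , false , t))
      rest-to (false , true  , t) = cong rest (to-flipOdd (false , false , t))
      rest-to (true  , true  , t) =
        trans (cong rest (to-flipEven (false , true , t))) (rest-to (false , true , t))

      restMap-mono : ∀ {t t′} → Adj t t′ → Adj (restMap t) (restMap t′)
      restMap-mono e = proj₁ (to-high _ e)

      -- With even bit `false`, high edges keep the odd bit, so the pentagon at `t` lifts to a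
      -- closed walk at `u`. Its image consists of five high edges, and `highPentagon` applies.
      evenBit-to-false : ∀ u → evenBit u ≡ false → evenBit (to u) ≡ false
      evenBit-to-false (_ , _ , t) refl =
        let (_ , _ , _ , _ , e₁ , e₂ , e₃ , e₄ , e₅) = pentagon t
        in highPentagon (to-high _ e₁) (to-high _ e₂) (to-high _ e₃) (to-high _ e₄) (to-high _ e₅)

    restMap-inverse : (f g : Automorphism (Extend Adj)) →
      (∀ u → Automorphism.to f (Automorphism.to g u) ≡ u) → ∀ t → restMap f (restMap g t) ≡ t
    restMap-inverse f g fg t = trans (sym (rest-to f _)) (cong rest (fg (false , false , t)))

    restAutomorphism : Automorphism (Extend Adj) → Automorphism Adj
    restAutomorphism f = automorphism (restMap f) (restMap (inverse f))
      (restMap-inverse f (inverse f) to-from) (restMap-inverse (inverse f) f from-to)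
      (restMap-mono f) (restMap-mono (inverse f))
      where open Automorphism f

    evenBit-to : (f : Automorphism (Extend Adj)) → ∀ u → evenBit (Automorphism.to f u) ≡ evenBit u
    evenBit-to f u with evenBit u in eq | evenBit (Automorphism.to f u) in eq′
    ... | false | false = refl
    ... | true  | true  = refl
    ... | false | true  = trans (sym eq′) (evenBit-to-false f u eq)
    ... | true  | false = trans (sym (evenBit-to-false (inverse f) _ eq′))
                                (trans (cong evenBit (Automorphism.from-to f u)) eq)

  -- Automorphisms built on an extension.

  -- Adding `d` to the even bit changes by `d` what each high edge adds to the odd bit; the
  -- correction `h` must therefore change by `d` along every edge. For `d = false` it may be
  -- constant; for `d = true` it is a 2-colouring.
  shear : (φ : Automorphism Adj) (d : Bool) (h : V → Bool) →
          (∀ {s t} → Adj s t → h t ≡ d xor h s) → Automorphism (Extend Adj)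
  shear φ d h h-step = automorphism
    (λ (a , c , t) → d xor a , h t xor c , to t)
    (λ (a , c , t) → d xor a , h (from t) xor c , from t)
    (λ (a , c , t) → cong₂ _,_ (xor-cancel d a) (cong₂ _,_ (xor-cancel (h (from t)) c) (to-from t)))
    (λ (a , c , t) → cong₂ _,_ (xor-cancel d a) (cong₂ _,_
      (trans (cong (λ s → h s xor (h t xor c)) (from-to t)) (xor-cancel (h t) c)) (from-to t)))
    (mono to h (to-mono φ) h-step)
    -- The inverse has the same shape, with the correction read off at the preimage.
    (mono from (h ∘ from) (from-mono φ) (h-step ∘ from-mono φ))
    where
    open Automorphism φ
    shift : ∀ d a h c → (d xor h) xor (a xor c) ≡ (d xor a) xor (h xor c)
    shift false false _     _ = refl
    shift false true  false _ = refl
    shift false true  true  _ = refl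
    shift true  false false _ = refl
    shift true  false true  c = sym (not-involutive c)
    shift true  true  false c = not-involutive c
    shift true  true  true  _ = refl
    mono : (g : V → V) (h : V → Bool) → (∀ {s t} → Adj s t → Adj (g s) (g t)) →
           (∀ {s t} → Adj s t → h t ≡ d xor h s) → ∀ {u v} → Extend Adj u v →
           Extend Adj (d xor evenBit u , h (rest u) xor oddBit u , g (rest u))
                      (d xor evenBit v , h (rest v) xor oddBit v , g (rest v))
    mono g h g-mono step {a , _} (even refl)    = even (cong (_, _) (xor-not d a))
    mono g h g-mono step {_ , c , t} (odd refl) = odd (cong (λ z → _ , z , _) (xor-not (h t) c))
    mono g h g-mono step {a , c , t} (high e refl) = high (g-mono e)
      (cong (λ z → _ , z , _) (trans (cong (_xor (a xor c)) (step e)) (shift d a (h t) c)))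

  extend-sameOrbit : ∀ {a c c′ t t′} → SameOrbit Adj t t′ →
                     SameOrbit (Extend Adj) (a , c , t) (a , c′ , t′)
  extend-sameOrbit {a} {c} {c′} (φ , refl) =
    -- The constant `c xor c′` is the one that sends `c` to `c′`.
    shear φ false (λ _ → c xor c′) (λ _ → refl) , cong (λ z → a , z , _) (xor-swap c c′)

  sameOrbit-trans : ∀ {u v w} → SameOrbit Adj u v → SameOrbit Adj v w → SameOrbit Adj u w
  sameOrbit-trans (f , refl) (g , refl) =
    automorphism (g.to ∘ f.to) (f.from ∘ g.from)
      (λ v → trans (cong g.to (f.to-from _)) (g.to-from v))
      (λ v → trans (cong f.from (g.from-to _)) (f.from-to v))
      (to-mono g ∘ to-mono f) (from-mono f ∘ from-mono g) , refl
    where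
    module f = Automorphism f
    module g = Automorphism g

-- Transitivity and orbit counts of extensions.

Transitive : {V : Set} → (V → V → Set) → Set
Transitive Adj = ∀ u v → SameOrbit Adj u v

Bipartite : {V : Set} → (V → V → Set) → Set
Bipartite {V} Adj = Σ[ h ∈ (V → Bool) ] (∀ {s t} → Adj s t → h t ≡ not (h s))

extend-transitive : ∀ {V} {Adj : V → V → Set} → Bipartite Adj →
                    Transitive Adj → Transitive (Extend Adj)
extend-transitive {Adj = Adj} (h , h-step) tr (a , c , t) (a′ , c′ , t′) =
  sameOrbit-trans (toEven a a′) (extend-sameOrbit (tr t t′))
  where
  -- The odd bit `h t xor c` is what the shear by `h` leaves; the second move corrects it together
  -- with `t`.
  toEven : ∀ a a′ → SameOrbit (Extend Adj) (a , c , t) (a′ , h t xor c , t)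
  toEven false false = extend-sameOrbit (identity , refl)
  toEven true  true  = extend-sameOrbit (identity , refl)
  toEven false true  = shear identity true h h-step , refl
  toEven true  false = shear identity true h h-step , refl

transitive-orbitCount : ∀ {V} {Adj : V → V → Set} → V → Transitive Adj → OrbitCount Adj 1
transitive-orbitCount v tr =
  (λ _ → zero) , strictlySurjective⇒surjective (λ { zero → v , refl }) ,
  λ u v → mk⇔ (λ _ → tr u v) (λ _ → refl)

-- An orbit is coded by the even bit and the orbit of the rest: `extend-sameOrbit` absorbs the odd
-- bit, while `evenBit-to` and `restAutomorphism` show that both data are invariant.
extend-orbitCount : ∀ {V} {Adj : V → V → Set} {k} → Rich Adj →
                    OrbitCount Adj k → OrbitCount (Extend Adj) (2 * k)
extend-orbitCount {V} {Adj} {k} rich (c , c-surj , c-orbit) =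
  colour , strictlySurjective⇒surjective surj , λ u v → mk⇔ (sound u v) (complete u v)
  where
  module B = Inverse 2↔Bool
  colour : Pairs V → Fin (2 * k)
  colour (a , _ , t) = combine (B.from a) (c t)
  surj : ∀ i → ∃[ u ] colour u ≡ i
  surj i =
    let (b , j , eq) = combine-surjective {2} i
        (t , ct≡)    = c-surj j
    in (B.to b , false , t) , trans (cong₂ combine (B.strictlyInverseʳ b) (ct≡ refl)) eq
  sound : ∀ u v → colour u ≡ colour v → SameOrbit (Extend Adj) u v
  sound (a , _ , t) (a′ , _ , t′) e with combine-injective (B.from a) (c t) (B.from a′) (c t′) e
  ... | ea , et with trans (sym (B.strictlyInverseˡ a)) (trans (cong B.to ea) (B.strictlyInverseˡ a′))
  ... | refl = extend-sameOrbit ((c-orbit t t′ ⟶) et)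
  complete : ∀ u v → SameOrbit (Extend Adj) u v → colour u ≡ colour v
  complete u _ (f , refl) = cong₂ combine
    (cong B.from (sym (evenBit-to rich f u)))
    ((c-orbit _ _ ⟵) (restAutomorphism rich f , sym (rest-to rich f u)))

-- Crossed cubes as iterated extensions.

Vertex : ℕ → Set
Vertex 0 = ⊤
Vertex 1 = Bool
Vertex (suc (suc n)) = Pairs (Vertex n)

Crossed : (n : ℕ) → Vertex n → Vertex n → Set
Crossed 0 _ _ = ⊥
Crossed 1 b b′ = b′ ≡ not b
Crossed (suc (suc n)) = Extend (Crossed n)

crossed-simple : ∀ n → Simple (Crossed n)
crossed-simple 0 = record { irreflexive = λ () ; symmetric = λ () }
crossed-simple 1 = record
  { irreflexive = λ { {u} refl e → not-¬ refl e }
  ; symmetric   = λ { {u} refl → sym (not-involutive u) } }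
crossed-simple (suc (suc n)) = extend-simple (crossed-simple n)

crossed-neighbour : ∀ n (u : Vertex (suc n)) → ∃ (Crossed (suc n) u)
crossed-neighbour zero    b = not b , refl
crossed-neighbour (suc n) u = flipEven u , even refl

-- Richness starts at dimension 3, as the lifted pentagon needs an edge two dimensions lower.
crossed-rich : ∀ n → Rich (Crossed (3 + n))
crossed-rich n = extend-rich (crossed-simple (suc n)) (crossed-neighbour n)

crossed₁-bipartite : Bipartite (Crossed 1)
crossed₁-bipartite = (λ b → b) , λ e → e

crossed₂-bipartite : Bipartite (Crossed 2)
crossed₂-bipartite = (λ (a , c , _) → a xor c) , step
  where
  step : ∀ {s t} → Crossed 2 s t → evenBit t xor oddBit t ≡ not (evenBit s xor oddBit s)
  step {a , c , _} (even refl) = not-xor a c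
  step {a , c , _} (odd refl)  = xor-not a c
  step (high () _)

crossed₁-transitive : Transitive (Crossed 1)
crossed₁-transitive u v = automorphism (d xor_) (d xor_) (xor-cancel d) (xor-cancel d) mono mono , xor-swap u v
  where
  d = u xor v
  mono : ∀ {b b′} → Crossed 1 b b′ → Crossed 1 (d xor b) (d xor b′)
  mono {b} refl = xor-not d b

crossed₂-transitive : Transitive (Crossed 2)
crossed₂-transitive = extend-transitive ((λ _ → false) , λ ()) λ _ _ → identity , refl

-- The induction goes by two dimensions from 3 and 4. The exponent agrees by computation with
-- `⌈ 3 + n /2⌉ ∸ 2`.
crossed-orbitCount : ∀ n → OrbitCount (Crossed (3 + n)) (2 ^ ⌊ n /2⌋)
crossed-orbitCount 0 = transitive-orbitCount (false , false , false)
  (extend-transitive crossed₁-bipartite crossed₁-transitive)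
crossed-orbitCount 1 = transitive-orbitCount (false , false , false , false , tt)
  (extend-transitive crossed₂-bipartite crossed₂-transitive)
crossed-orbitCount (suc (suc n)) = extend-orbitCount (crossed-rich n) (crossed-orbitCount n)

-- Agreement with the bitwise adjacency.

bit-injective : ∀ {n} {u v : Vec Bool n} → (∀ i → i < n → bit v i ≡ bit u i) → v ≡ u
bit-injective {u = []}    {[]}    _ = refl
bit-injective {u = _ ∷ _} {_ ∷ _} e =
  cong₂ _∷_ (e 0 z<s) (bit-injective λ i i<n → e (suc i) (s<s i<n))

[2+n]/2 : ∀ n → (2 + n) / 2 ≡ suc (n / 2)
[2+n]/2 n = +-distrib-/-∣ˡ n {2} ∣-refl

pairRel⇒ : ∀ {a c a′ c′} → PairRel c a c′ a′ → a′ ≡ a × c′ ≡ a xor c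
pairRel⇒ p00-00 = refl , refl
pairRel⇒ p10-10 = refl , refl
pairRel⇒ p01-11 = refl , refl
pairRel⇒ p11-01 = refl , refl

pairRel⇐ : ∀ a c → PairRel c a (a xor c) a
pairRel⇐ false false = p00-00
pairRel⇐ false true  = p10-10
pairRel⇐ true  false = p01-11
pairRel⇐ true  true  = p11-01

PairRelAt : ∀ {n} → Vec Bool n → Vec Bool n → ℕ → Set
PairRelAt u v k = PairRel (bit u (k + 1)) (bit u k) (bit v (k + 1)) (bit v k)

-- The index `x` selects the kind of edge: 0 is even, 1 is odd, and `2 + x` is a high edge of index
-- `x` in the rest, whose lowest pair obeys the pair relation at `i = 0`.
cqAdj⇒extend : ∀ {n a c a′ c′} {t t′ : Vec Bool n} →
  CQAdj (2 + n) (a ∷ c ∷ t) (a′ ∷ c′ ∷ t′) → Extend (CQAdj n) (a , c , t) (a′ , c′ , t′)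
cqAdj⇒extend (0 , _ , flip , _ , above , _) =
  even (cong₂ _,_ (¬-not flip) (cong₂ _,_ (above 1 (s≤s z≤n) (s≤s (s≤s z≤n)))
    (bit-injective λ i i<n → above (2 + i) z<s (s<s (s<s i<n)))))
cqAdj⇒extend (1 , _ , flip , keep , above , _) =
  odd (cong₂ _,_ (keep refl) (cong₂ _,_ (¬-not flip)
    (bit-injective λ i i<n → above (2 + i) (s<s z<s) (s<s (s<s i<n)))))
cqAdj⇒extend {n} {a} {c} {a′} {c′} {t} {t′} (suc (suc x) , s≤s (s≤s x<n) , flip , keep , above , below) =
  let (ea , ec) = pairRel⇒ (below 0 (subst (0 <_) (sym ([2+n]/2 x)) z<s)) in
  high (x , x<n , flip , keep′ x keep , (λ i x<i i<n → above (2 + i) (s<s (s<s x<i)) (s<s (s<s i<n))) ,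
        λ i i<x → subst (PairRelAt (a ∷ c ∷ t) (a′ ∷ c′ ∷ t′)) (*-suc 2 i)
          (below (suc i) (subst (suc i <_) (sym ([2+n]/2 x)) (s<s i<x))))
       (cong₂ _,_ ea (cong (_, t′) ec))
  where
  keep′ : ∀ x → (x % 2 ≡ 1 → bit (_ ∷ t′) x ≡ bit (_ ∷ t) x) →
          x % 2 ≡ 1 → bit t′ (x ∸ 1) ≡ bit t (x ∸ 1)
  -- At index 0 the subtraction truncates and the two bits differ in position, but `0 % 2 ≡ 1` is
  -- absurd.
  keep′ (suc x) k = k

extend⇒cqAdj : ∀ {n a c a′ c′} {t t′ : Vec Bool n} →
  Extend (CQAdj n) (a , c , t) (a′ , c′ , t′) → CQAdj (2 + n) (a ∷ c ∷ t) (a′ ∷ c′ ∷ t′)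
extend⇒cqAdj (even refl) =
  0 , z<s , (λ e → not-¬ refl (sym e)) , (λ ()) , (λ { (suc i) _ _ → refl }) , λ _ ()
extend⇒cqAdj (odd refl) =
  1 , s<s z<s , (λ e → not-¬ refl (sym e)) , (λ _ → refl) ,
  (λ { (suc zero) (s≤s ()) _ ; (suc (suc i)) _ _ → refl }) , λ _ ()
extend⇒cqAdj {n} {a} {c} {t = t} {t′} (high (x , x<n , flip , keep , above , below) refl) =
  2 + x , s<s (s<s x<n) , flip , keep′ x keep ,
  (λ { (suc (suc i)) (s≤s (s≤s x<i)) (s≤s (s≤s i<n)) → above i x<i i<n
     ; (suc zero) (s≤s ()) _ }) ,
  λ i i<x → below′ i (subst (i <_) ([2+n]/2 x) i<x)
  where
  keep′ : ∀ x → (x % 2 ≡ 1 → bit t′ (x ∸ 1) ≡ bit t (x ∸ 1)) →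
          x % 2 ≡ 1 → bit (_ ∷ t′) x ≡ bit (_ ∷ t) x
  keep′ (suc x) k = k
  below′ : ∀ i → i < suc (x / 2) → PairRelAt (a ∷ c ∷ t) (a ∷ (a xor c) ∷ t′) (2 * i)
  below′ zero    _         = pairRel⇐ a c
  below′ (suc i) (s≤s i<x) = subst (PairRelAt (a ∷ c ∷ t) (a ∷ (a xor c) ∷ t′)) (sym (*-suc 2 i)) (below i i<x)

encode : ∀ {n} → Vec Bool n → Vertex n
encode []          = tt
encode (b ∷ [])    = b
encode (a ∷ c ∷ t) = a , c , encode t

decode : ∀ n → Vertex n → Vec Bool n
decode 0 _ = []
decode 1 b = b ∷ []
decode (suc (suc n)) (a , c , t) = a ∷ c ∷ decode n t

decode-encode : ∀ {n} (v : Vec Bool n) → decode n (encode v) ≡ v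
decode-encode []          = refl
decode-encode (_ ∷ [])    = refl
decode-encode (a ∷ c ∷ t) = cong (λ t → a ∷ c ∷ t) (decode-encode t)

encode-decode : ∀ n (v : Vertex n) → encode (decode n v) ≡ v
encode-decode 0 _ = refl
encode-decode 1 _ = refl
encode-decode (suc (suc n)) (a , c , t) = cong (λ t → a , c , t) (encode-decode n t)

extend-map : ∀ {V W} {Adj : V → V → Set} {Adj′ : W → W → Set} (g : V → W) →
  (∀ s t → Adj s t → Adj′ (g s) (g t)) → ∀ {a c a′ c′ t t′} →
  Extend Adj (a , c , t) (a′ , c′ , t′) → Extend Adj′ (a , c , g t) (a′ , c′ , g t′)
extend-map g mono (even refl)   = even refl
extend-map g mono (odd refl)    = odd refl
extend-map g mono (high e refl) = high (mono _ _ e) refl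

encode-mono : ∀ {n} (u v : Vec Bool n) → CQAdj n u v → Crossed n (encode u) (encode v)
encode-mono [] [] (_ , () , _)
encode-mono (_ ∷ []) (_ ∷ []) (zero , _ , flip , _) = ¬-not flip
encode-mono (_ ∷ []) (_ ∷ []) (suc _ , s≤s () , _)
encode-mono (_ ∷ _ ∷ t) (_ ∷ _ ∷ t′) e = extend-map encode encode-mono (cqAdj⇒extend e)

decode-mono : ∀ n (u v : Vertex n) → Crossed n u v → CQAdj n (decode n u) (decode n v)
decode-mono 1 _ _ refl =
  0 , z<s , (λ e → not-¬ refl (sym e)) , (λ ()) , (λ { (suc _) _ (s≤s ()) }) , λ _ ()
decode-mono (suc (suc n)) _ _ e = extend⇒cqAdj (extend-map (decode n) (decode-mono n) e)

-- Transport of orbit counts along an isomorphism.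

module _ {V W : Set} {Adj : V → V → Set} {Adj′ : W → W → Set}
         (g : V → W) (h : W → V) (gh : ∀ w → g (h w) ≡ w) (hg : ∀ v → h (g v) ≡ v)
         (g-mono : ∀ u v → Adj u v → Adj′ (g u) (g v))
         (h-mono : ∀ u v → Adj′ u v → Adj (h u) (h v)) where

  automorphism-transport : Automorphism Adj → Automorphism Adj′
  automorphism-transport f = automorphism (g ∘ to ∘ h) (g ∘ from ∘ h)
    (λ w → trans (cong (g ∘ to) (hg _)) (trans (cong g (to-from _)) (gh w)))
    (λ w → trans (cong (g ∘ from) (hg _)) (trans (cong g (from-to _)) (gh w)))
    (g-mono _ _ ∘ to-mono f ∘ h-mono _ _) (g-mono _ _ ∘ from-mono f ∘ h-mono _ _)
    where open Automorphism f

  sameOrbit-transport : ∀ {u v} → SameOrbit Adj u v → SameOrbit Adj′ (g u) (g v)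
  sameOrbit-transport (f , refl) = automorphism-transport f , cong (g ∘ Automorphism.to f) (hg _)

orbitCount-transport : ∀ {V W} {Adj : V → V → Set} {Adj′ : W → W → Set}
  (g : V → W) (h : W → V) → (∀ w → g (h w) ≡ w) → (∀ v → h (g v) ≡ v) →
  (∀ u v → Adj u v → Adj′ (g u) (g v)) → (∀ u v → Adj′ u v → Adj (h u) (h v)) →
  ∀ {k} → OrbitCount Adj k → OrbitCount Adj′ k
orbitCount-transport {Adj′ = Adj′} g h gh hg g-mono h-mono (c , c-surj , c-orbit) =
  c ∘ h ,
  strictlySurjective⇒surjective (λ i → let (v , cv≡) = c-surj i in g v , cv≡ (hg v)) ,
  λ u v → mk⇔
    (λ e → subst₂ (SameOrbit Adj′) (gh u) (gh v)
      (sameOrbit-transport g h gh hg g-mono h-mono ((c-orbit _ _ ⟶) e)))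
    (λ s → (c-orbit _ _ ⟵) (sameOrbit-transport h g hg gh h-mono g-mono s))

theorem2 : (n : ℕ) → 3 ≤ n → OrbitCount (CQAdj n) (2 ^ (⌈ n /2⌉ ∸ 2))
theorem2 n@(suc (suc (suc k))) (s≤s (s≤s (s≤s z≤n))) =
  orbitCount-transport (decode n) encode decode-encode (encode-decode n)
    (decode-mono n) encode-mono (crossed-orbitCount k)
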